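{- Let $d=39028039587479$. Then $d$ is a prime number with $d\equiv 3 \pmod 4$, and if $\varepsilon>1$ denotes the fundamental unit of the ring of integers $\mathcal{O}_K=\mathbb{Z}[\sqrt{d}]$ of $K=\mathbb{Q}(\sqrt{d})$, written as $\varepsilon=x+y\sqrt{d}$ with $x,y\in\mathbb{N}_0$, then $d\mid y$. In other words, $d$ is a counterexample to Mordell's Pellian Equation Conjecture.
   Context: Mordell's Pellian Equation Conjecture asserts: if $d$ is a prime with $d\equiv 3\pmod 4$, $K=\mathbb{Q}(\sqrt{d})$, $\varepsilon>1$ is the fundamental unit of the ring of integers $\mathcal{O}_K=\mathbb{Z}[\sqrt{d}]$ (i.e. the smallest unit greater than $1$, generating $\mathcal{O}_K^{\times}$ modulo $\pm1$), and $\varepsilon=x+y\sqrt{d}$ with $x,y\in\mathbb{N}_0$, then $d\nmid y$. Here $\mathbb{N}_0$ denotes the set of nonnegative integers. -}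

module Defs where

open import Data.Nat using (ℕ)
open import Data.Integer using (ℤ; +_; _+_; _-_; _*_; -_; _≤_; _<_; 0ℤ; 1ℤ)
open import Data.Product using (_×_; _,_; Σ)
open import Data.Sum using (_⊎_)
open import Relation.Binary.PropositionalEquality using (_≡_)
open import Relation.Nullary using (¬_)

-- Elements of the ring ℤ[√d]: a pair (a , b) represents a + b√d.
ℤ[√_] : ℕ → Set
ℤ[√ d ] = ℤ × ℤ

module _ (d : ℕ) where

  one : ℤ[√ d ]
  one = 1ℤ , 0ℤ

  mul : ℤ[√ d ] → ℤ[√ d ] → ℤ[√ d ]
  mul (a , b) (c , e) = (a * c + (+ d) * (b * e)) , (a * e + b * c)

  sub : ℤ[√ d ] → ℤ[√ d ] → ℤ[√ d ]
  sub (a , b) (c , e) = (a - c) , (b - e)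

  IsUnit : ℤ[√ d ] → Set
  IsUnit u = Σ (ℤ[√ d ]) (λ v → mul u v ≡ one)

  -- a + b√d > 0 as a real number (d ≥ 0, √d the nonnegative root),
  -- decided by comparing squares.
  Pos : ℤ[√ d ] → Set
  Pos (a , b) =
      (0ℤ ≤ a × 0ℤ ≤ b × ¬ (a ≡ 0ℤ × b ≡ 0ℤ))
    ⊎ (0ℤ < a × b < 0ℤ × (+ d) * (b * b) < a * a)
    ⊎ (a < 0ℤ × 0ℤ < b × a * a < (+ d) * (b * b))

  -- real order on ℤ[√d] via the embedding a + b√d ↦ a + b·√d
  _≺_ : ℤ[√ d ] → ℤ[√ d ] → Set
  u ≺ v = Pos (sub v u)

  _≼_ : ℤ[√ d ] → ℤ[√ d ] → Set
  u ≼ v = u ≡ v ⊎ u ≺ v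

  IsFundamentalUnit : ℤ[√ d ] → Set
  IsFundamentalUnit ε =
    IsUnit ε × one ≺ ε × ((η : ℤ[√ d ]) → IsUnit η → one ≺ η → ε ≼ η)

{-# OPTIONS --safe #-}
-- A unit greater than 1 is a positive solution of the Pell equation a² = 1 + d b², because
-- d ≡ 3 (mod 4) excludes norm −1. If x + y√d is the least one, every solution a + b√d is
-- (x + y√d)ᵏ for some k, whence x b ≡ k y a (mod d) and 2ᵏ ≤ a. So a single solution with
-- d ∣ b and a < 2ᵈ suffices: then 0 < k < d and d ∣ k y a, so d ∣ y. In particular that
-- solution need not be known to be fundamental. It is β²/2 for an element β of norm 2 with
-- about three million bits, which a compact representation describes by seventeen doublings.
module Submission where

open import Defs
open import Data.Nat using (ℕ; _%_)
open import Data.Nat.Divisibility using (_∣_)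
open import Data.Nat.Primality using (Prime)
open import Data.Integer using (+_)
open import Data.Product using (_×_; _,_; ∃₂)
open import Relation.Binary.PropositionalEquality using (_≡_)

open import Data.Bool using (Bool; true; false; _∧_; T)
open import Data.Bool.Properties using (T-∧)
open import Data.Empty using (⊥; ⊥-elim)
open import Data.Fin using (toℕ)
open import Data.Fin.Properties using (all?; toℕ-fromℕ<)
open import Data.Integer using (ℤ; -[1+_]; 0ℤ; 1ℤ; ∣_∣; +≤+; +<+)
import Data.Integer as ℤ
import Data.Integer.Properties as ℤ
import Data.Integer.Tactic.RingSolver as ℤ-Solver
open import Data.Nat using (zero; suc; _+_; _*_; _∸_; _^_; _/_; _≤_; _<_; z≤n; s≤s; z<s; NonZero; NonTrivial; nonTrivial⇒≢1; >-nonZero; >-nonZero⁻¹; _≡ᵇ_; _<ᵇ_; _≟_)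
open import Data.Nat.DivMod using (_mod_; m%n<n; %-distribˡ-+; %-distribˡ-*)
open import Data.Nat.Divisibility using (_∤_; ∣⇒≤; ∣1⇒≡1; m%n≡0⇒n∣m; n∣m⇒m%n≡0; ∣m+n∣m⇒∣n; ∣m∣n⇒∣m+n; m∣m*n; ∣m⇒∣m*n; ∣n⇒∣m*n)
open import Data.Nat.Induction using (<-rec)
open import Data.Nat.Primality using (_Rough_; 2-rough; ∤⇒rough-suc; rough∧square>⇒prime; euclidsLemma; prime⇒nonTrivial; prime⇒nonZero)
open import Data.Nat.Properties
open import Data.Nat.Tactic.RingSolver using (solve-∀)
open import Data.Product using (∃)
open import Data.Sum using (_⊎_; inj₁; inj₂; [_,_]′)
open import Data.Unit using (tt)
open import Function.Bundles using (Equivalence)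
open import Relation.Binary.PropositionalEquality using (refl; sym; trans; cong; cong₂; subst; subst₂; module ≡-Reasoning)
open import Relation.Nullary using (¬_; Dec; yes; no; contradiction)
open import Relation.Nullary.Decidable using (toWitness; ¬?; map′)

-- Arithmetic

-- Inequalities between products of coordinates are proved on their squares, where Pell's equation
-- can be substituted.
m*m≤n*n⇒m≤n : ∀ {m n} → m * m ≤ n * n → m ≤ n
m*m≤n*n⇒m≤n le = ≮⇒≥ λ n<m → <⇒≱ (*-mono-< n<m n<m) le

m*m<n*n⇒m<n : ∀ {m n} → m * m < n * n → m < n
m*m<n*n⇒m<n lt = ≰⇒> λ n≤m → ≤⇒≯ (*-mono-≤ n≤m n≤m) lt

Least : (ℕ → Set) → ℕ → Set
Least P n = P n × (∀ k → P k → n ≤ k)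

module _ {P : ℕ → Set} (P? : ∀ n → Dec (P n)) where

  least-below : ∀ n → (∀ k → k < n → ¬ P k) ⊎ ∃ (Least P)
  least-below zero = inj₁ λ _ ()
  least-below (suc n) with least-below n
  ... | inj₂ found = inj₂ found
  ... | inj₁ none with P? n
  ...   | yes pn = inj₂ (n , pn , λ k pk → ≮⇒≥ λ k<n → none k k<n pk)
  ...   | no ¬pn = inj₁ λ k k<1+n pk →
            [ (λ k<n → none k k<n pk) , (λ { refl → ¬pn pk }) ]′ (m≤n⇒m<n∨m≡n (≤-pred k<1+n))

  least : ∃ P → ∃ (Least P)
  least (n , pn) with least-below (suc n)
  ... | inj₁ none = contradiction pn (none n ≤-refl)
  ... | inj₂ found = found

-- Primality by trial division

survivesTrials : ℕ → ℕ → ℕ → Bool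
survivesTrials n zero m = true
survivesTrials n (suc t) m with n % suc m
... | zero = false
... | suc _ = survivesTrials n t (suc m)

survivesTrials⇒rough : ∀ n t m → survivesTrials n t m ≡ true → suc m Rough n → (t + suc m) Rough n
survivesTrials⇒rough n zero m _ r = r
survivesTrials⇒rough n (suc t) m ok r with n % suc m in eq
... | suc _ = subst (_Rough n) (+-suc t (suc m))
                (survivesTrials⇒rough n t (suc m) ok (∤⇒rough-suc 1+m∤n r))
  where
  1+m∤n : suc m ∤ n
  1+m∤n 1+m∣n with () ← trans (sym eq) (n∣m⇒m%n≡0 n (suc m) 1+m∣n)

-- The trials by 2, ..., t + 1 leave no divisor below t + 2, whereas a composite `n` has one of size
-- at most √n < t + 2.
survivesTrials⇒prime : ∀ n .{{_ : NonTrivial n}} t → survivesTrials n t 1 ≡ true →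
                       n < (t + 2) * (t + 2) → Prime n
survivesTrials⇒prime n t ok n<s =
  rough∧square>⇒prime (survivesTrials⇒rough n t 1 ok 2-rough) n<s

-- Positive solutions of Pell's equation and units greater than one

record Pell (d a b : ℕ) : Set where
  constructor mkPell
  field
    equation : a * a ≡ 1 + d * (b * b)

open Pell

-- Squares are 0 or 1 modulo 4, so the left side is 1 or 2 and the right side 0 or 3. The sixteen
-- pairs of residues are checked by evaluation.
m*m+1≢d*n*n : ∀ d m n → d % 4 ≡ 3 → m * m + 1 ≡ d * (n * n) → ⊥
m*m+1≢d*n*n d m n d%4≡3 eq =
  toWitness {a? = all? λ i → all? λ j → ¬? (f (toℕ i) ≟ g (toℕ j))} _ (m mod 4) (n mod 4)
    (subst₂ (λ r s → f r ≡ g s) (toℕ-mod m) (toℕ-mod n) residues)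
  where
  f g : ℕ → ℕ
  f r = ((r * r) % 4 + 1) % 4
  g s = (3 * ((s * s) % 4)) % 4
  toℕ-mod : ∀ k → k % 4 ≡ toℕ (k mod 4)
  toℕ-mod k = sym (toℕ-fromℕ< (m%n<n k 4))
  residues : f (m % 4) ≡ g (n % 4)
  residues = begin
    ((m % 4 * (m % 4)) % 4 + 1) % 4      ≡⟨ cong (λ r → (r + 1) % 4) (%-distribˡ-* m m 4) ⟨
    ((m * m) % 4 + 1) % 4                ≡⟨ %-distribˡ-+ (m * m) 1 4 ⟨
    (m * m + 1) % 4                      ≡⟨ cong (_% 4) eq ⟩
    (d * (n * n)) % 4                    ≡⟨ %-distribˡ-* d (n * n) 4 ⟩
    (d % 4 * ((n * n) % 4)) % 4          ≡⟨ cong₂ (λ r s → (r * s) % 4) d%4≡3 (%-distribˡ-* n n 4) ⟩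
    (3 * ((n % 4 * (n % 4)) % 4)) % 4    ∎
    where open ≡-Reasoning

norm : ℕ → ℤ × ℤ → ℤ
norm d (a , b) = a ℤ.* a ℤ.- + d ℤ.* (b ℤ.* b)

norm-mul : ∀ d u v → norm d (mul d u v) ≡ norm d u ℤ.* norm d v
norm-mul d (a , b) (c , e) = identity (+ d) a b c e
  where
  identity : ∀ d a b c e →
    (a ℤ.* c ℤ.+ d ℤ.* (b ℤ.* e)) ℤ.* (a ℤ.* c ℤ.+ d ℤ.* (b ℤ.* e))
      ℤ.- d ℤ.* ((a ℤ.* e ℤ.+ b ℤ.* c) ℤ.* (a ℤ.* e ℤ.+ b ℤ.* c))
    ≡ (a ℤ.* a ℤ.- d ℤ.* (b ℤ.* b)) ℤ.* (c ℤ.* c ℤ.- d ℤ.* (e ℤ.* e))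
  identity = ℤ-Solver.solve-∀

i*i≡+∣i∣*∣i∣ : ∀ i → i ℤ.* i ≡ + (∣ i ∣ * ∣ i ∣)
i*i≡+∣i∣*∣i∣ (+ n) = sym (ℤ.pos-* n n)
i*i≡+∣i∣*∣i∣ -[1+ n ] = refl

norm≡∣a∣²-d∣b∣² : ∀ d a b → norm d (a , b) ≡ + (∣ a ∣ * ∣ a ∣) ℤ.- + (d * (∣ b ∣ * ∣ b ∣))
norm≡∣a∣²-d∣b∣² d a b = cong₂ ℤ._-_ (i*i≡+∣i∣*∣i∣ a)
  (trans (cong (+ d ℤ.*_) (i*i≡+∣i∣*∣i∣ b)) (sym (ℤ.pos-* d (∣ b ∣ * ∣ b ∣))))

i-j≡k⇒i≡k+j : ∀ i j k → i ℤ.- j ≡ k → i ≡ k ℤ.+ j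
i-j≡k⇒i≡k+j i j k refl = identity i j
  where
  identity : ∀ i j → i ≡ i ℤ.- j ℤ.+ j
  identity = ℤ-Solver.solve-∀

module _ (d : ℕ) (d%4≡3 : d % 4 ≡ 3) where

  -- The norm is not −1, since 3 is not a sum of two squares modulo 4.
  unit⇒pell : ∀ {a b} → IsUnit d (a , b) → Pell d ∣ a ∣ ∣ b ∣
  unit⇒pell {a} {b} (v , uv≡1) = mkPell (by-sign (norm d (a , b)) refl ∣norm∣≡1)
    where
    A = ∣ a ∣ * ∣ a ∣
    B = d * (∣ b ∣ * ∣ b ∣)
    ∣norm∣≡1 : ∣ norm d (a , b) ∣ ≡ 1
    ∣norm∣≡1 = m*n≡1⇒m≡1 _ ∣ norm d v ∣ (begin
      ∣ norm d (a , b) ∣ * ∣ norm d v ∣   ≡⟨ ℤ.∣i*j∣≡∣i∣*∣j∣ (norm d (a , b)) (norm d v) ⟨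
      ∣ norm d (a , b) ℤ.* norm d v ∣     ≡⟨ cong ∣_∣ (norm-mul d (a , b) v) ⟨
      ∣ norm d (mul d (a , b) v) ∣        ≡⟨ cong (λ w → ∣ norm d w ∣) uv≡1 ⟩
      ∣ 1ℤ ℤ.- + d ℤ.* 0ℤ ∣               ≡⟨ cong (λ i → ∣ 1ℤ ℤ.- i ∣) (ℤ.*-zeroʳ (+ d)) ⟩
      1                                   ∎)
      where open ≡-Reasoning
    by-sign : ∀ i → norm d (a , b) ≡ i → ∣ i ∣ ≡ 1 → A ≡ 1 + B
    by-sign (+ _) eq refl =
      ℤ.+-injective (i-j≡k⇒i≡k+j (+ A) (+ B) 1ℤ (trans (sym (norm≡∣a∣²-d∣b∣² d a b)) eq))
    by-sign -[1+ 0 ] eq refl = ⊥-elim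
      (m*m+1≢d*n*n d ∣ a ∣ ∣ b ∣ d%4≡3 (ℤ.+-injective (trans (cong (ℤ._+ 1ℤ) A≡) (identity (+ B)))))
      where
      A≡ : + A ≡ ℤ.- 1ℤ ℤ.+ + B
      A≡ = i-j≡k⇒i≡k+j (+ A) (+ B) (ℤ.- 1ℤ) (trans (sym (norm≡∣a∣²-d∣b∣² d a b)) eq)
      identity : ∀ i → ℤ.- 1ℤ ℤ.+ i ℤ.+ 1ℤ ≡ i
      identity = ℤ-Solver.solve-∀

  -- If b = 0 then a > 0 forces a = 1, which is not above 1. The remaining sign cases of `Pos`
  -- compare d b² with (a - 1)² in a way that contradicts d b² = a² - 1.
  unit≻1⇒positive : ∀ {a b} → IsUnit d (a , b) → _≺_ d (one d) (a , b) →
                    ∃₂ λ m n → (a , b) ≡ (+ m , + suc n) × Pell d m (suc n)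
  unit≻1⇒positive {a} {b} u 1≺u = cases a b (unit⇒pell {a} {b} u) 1≺u
    where
    1+m²≡1+n⇒m²≤n : ∀ m {n} → suc m * suc m ≡ 1 + n → m * m ≤ n
    1+m²≡1+n⇒m²≤n m {n} eq = ≤-trans (*-monoʳ-≤ m (n≤1+n m))
      (≤-trans (m≤n+m (m * suc m) m) (≤-reflexive (suc-injective eq)))
    cases : ∀ a b → Pell d ∣ a ∣ ∣ b ∣ → _≺_ d (one d) (a , b) →
            ∃₂ λ m n → (a , b) ≡ (+ m , + suc n) × Pell d m (suc n)
    cases (+ zero) b (mkPell ()) _
    cases (+ suc m) (+ suc n) pell _ = suc m , n , refl , pell
    cases (+ suc m) (+ zero) pell 1≺u
      with refl ← m*n≡1⇒m≡1 (suc m) (suc m) (trans (equation pell) (cong suc (*-zeroʳ d)))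
      with 1≺u
    ... | inj₁ (_ , _ , nonzero) = contradiction (refl , refl) nonzero
    ... | inj₂ (inj₁ (+<+ () , _))
    ... | inj₂ (inj₂ (+<+ () , _))
    cases (+ suc m) -[1+ n ] pell (inj₁ (_ , () , _))
    -- Here d b² < (a - 1)², but a ≥ 1 gives (a - 1)² ≤ a² - 1 = d b².
    cases (+ suc m) -[1+ n ] pell (inj₂ (inj₁ (_ , _ , lt))) =
      contradiction (ℤ.drop‿+<+ (subst₂ ℤ._<_ (sym (ℤ.pos-* d (suc n * suc n))) (i*i≡+∣i∣*∣i∣ (+ m)) lt))
        (≤⇒≯ (1+m²≡1+n⇒m²≤n m (equation pell)))
    cases (+ suc m) -[1+ n ] pell (inj₂ (inj₂ (+<+ () , _)))
    cases -[1+ m ] b pell (inj₁ (() , _))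
    cases -[1+ m ] b pell (inj₂ (inj₁ (() , _)))
    -- Here (a - 1)² < d b² = a² - 1, impossible for negative a.
    cases -[1+ m ] b pell (inj₂ (inj₂ (_ , _ , lt))) =
      contradiction (ℤ.drop‿+<+ (subst ((+ (suc (suc (m + 0)) * suc (suc (m + 0)))) ℤ.<_) rhs lt))
        (≤⇒≯ (≤-trans (≤-trans (n≤1+n _) (≤-reflexive (sym (equation pell)))) (*-mono-≤ bound bound)))
      where
      bound : suc m ≤ suc (suc (m + 0))
      bound = s≤s (≤-trans (m≤m+n m 0) (n≤1+n _))
      rhs : + d ℤ.* ((b ℤ.- 0ℤ) ℤ.* (b ℤ.- 0ℤ)) ≡ + (d * (∣ b ∣ * ∣ b ∣))
      rhs = trans (cong (λ i → + d ℤ.* (i ℤ.* i)) (ℤ.+-identityʳ b))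
        (trans (cong (+ d ℤ.*_) (i*i≡+∣i∣*∣i∣ b)) (sym (ℤ.pos-* d (∣ b ∣ * ∣ b ∣))))

module _ (d : ℕ) where

  pell⇒unit : ∀ {m n} → Pell d m n → IsUnit d (+ m , + n)
  pell⇒unit {m} {n} pell = (+ m , ℤ.- + n) , cong₂ _,_ first (second (+ m) (+ n))
    where
    second : ∀ i j → i ℤ.* (ℤ.- j) ℤ.+ j ℤ.* i ≡ 0ℤ
    second = ℤ-Solver.solve-∀
    rearrange : ∀ i j k → i ℤ.* i ℤ.+ k ℤ.* (j ℤ.* ℤ.- j) ≡ i ℤ.* i ℤ.- k ℤ.* (j ℤ.* j)
    rearrange = ℤ-Solver.solve-∀
    cancel : ∀ i → 1ℤ ℤ.+ i ℤ.- i ≡ 1ℤ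
    cancel = ℤ-Solver.solve-∀
    first : + m ℤ.* + m ℤ.+ + d ℤ.* (+ n ℤ.* ℤ.- + n) ≡ 1ℤ
    first = trans (rearrange (+ m) (+ n) (+ d)) (trans (norm≡∣a∣²-d∣b∣² d (+ m) (+ n))
      (trans (cong (λ k → + k ℤ.- + (d * (n * n))) (equation pell)) (cancel (+ (d * (n * n))))))

  pell⇒1≺ : ∀ {m n} → Pell d m (suc n) → _≺_ d (one d) (+ m , + suc n)
  pell⇒1≺ {zero} (mkPell ())
  pell⇒1≺ {suc m} _ = inj₁ (+≤+ z≤n , +≤+ z≤n , λ { (_ , ()) })

  -- The first coordinate of a solution increases with the second, which reduces the real order on
  -- solutions to the order of ℕ on second coordinates.
  pell-mono-≤ : ∀ {m n m′ n′} → Pell d m n → Pell d m′ n′ → n ≤ n′ → m ≤ m′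
  pell-mono-≤ {m} {n} {m′} {n′} p p′ n≤n′ = m*m≤n*n⇒m≤n
    (subst₂ _≤_ (sym (equation p)) (sym (equation p′)) (s≤s (*-monoʳ-≤ d (*-mono-≤ n≤n′ n≤n′))))

  pell-mono-< : .{{_ : NonZero d}} → ∀ {m n m′ n′} → Pell d m n → Pell d m′ n′ → n < n′ → m < m′
  pell-mono-< {m} {n} {m′} {n′} p p′ n<n′ = m*m<n*n⇒m<n
    (subst₂ _<_ (sym (equation p)) (sym (equation p′)) (s≤s (*-monoʳ-< d (*-mono-< n<n′ n<n′))))

  ≤⇒≼ : ∀ {m n m′ n′} → Pell d m n → Pell d m′ n′ → n ≤ n′ → _≼_ d (+ m , + n) (+ m′ , + n′)
  ≤⇒≼ {m} {n} {m′} {n′} p p′ n≤n′ with m≤n⇒m<n∨m≡n n≤n′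
  ... | inj₁ n<n′ = inj₂ (inj₁ (ℤ.i≤j⇒0≤j-i (+≤+ (pell-mono-≤ p p′ n≤n′)) , ℤ.i≤j⇒0≤j-i (+≤+ n≤n′) ,
          λ (_ , eq) → <⇒≢ n<n′ (sym (ℤ.+-injective (ℤ.i-j≡0⇒i≡j (+ n′) (+ n) eq)))))
  ... | inj₂ refl = inj₁ (cong (λ k → + k , + n) (≤-antisym (pell-mono-≤ p p′ ≤-refl) (pell-mono-≤ p′ p ≤-refl)))

  ≼⇒≤ : .{{_ : NonZero d}} → ∀ {m n m′ n′} → Pell d m n → Pell d m′ n′ →
         _≼_ d (+ m , + n) (+ m′ , + n′) → n ≤ n′
  ≼⇒≤ p p′ (inj₁ refl) = ≤-refl
  ≼⇒≤ p p′ (inj₂ (inj₁ (_ , 0≤j-i , _))) = ℤ.drop‿+≤+ (ℤ.0≤i-j⇒j≤i 0≤j-i)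
  ≼⇒≤ p p′ (inj₂ (inj₂ (inj₁ (0<j-i , _)))) = ≮⇒≥ λ n′<n →
    <⇒≱ (pell-mono-< p′ p n′<n) (ℤ.drop‿+≤+ (ℤ.0≤i-j⇒j≤i (ℤ.<⇒≤ 0<j-i)))
  ≼⇒≤ p p′ (inj₂ (inj₂ (inj₂ (_ , 0<j-i , _)))) = ℤ.drop‿+≤+ (ℤ.0≤i-j⇒j≤i (ℤ.<⇒≤ 0<j-i))

-- The fundamental unit as the solution with least b

module _ (d : ℕ) (d%4≡3 : d % 4 ≡ 3) where

  pell⇒∃fundamental : (∃₂ λ m n → Pell d m (suc n)) → ∃₂ λ x y → IsFundamentalUnit d (+ x , + y)
  pell⇒∃fundamental (m , n , pell) =
    let (y , (x , _ , pellₓ) , minimal) = least solvable? (n , solution pell)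
    in x , suc y , pell⇒unit d pellₓ , pell⇒1≺ d pellₓ , smallest pellₓ minimal
    where
    -- The index `k` is b - 1, which keeps b positive. The bound on `l` follows from l ≤ l² = 1 + d
    -- b² and makes the predicate decidable.
    Solvable : ℕ → Set
    Solvable k = ∃ λ l → l < 2 + d * (suc k * suc k) × Pell d l (suc k)
    solvable? : ∀ k → Dec (Solvable k)
    solvable? k = anyUpTo? (λ l → map′ mkPell equation (l * l ≟ 1 + d * (suc k * suc k))) (2 + d * (suc k * suc k))
    l≤l*l : ∀ l → l ≤ l * l
    l≤l*l zero = z≤n
    l≤l*l l@(suc _) = m≤m*n l l
    solution : ∀ {l k} → Pell d l (suc k) → Solvable k
    solution {l} p = l , s≤s (≤-trans (l≤l*l l) (≤-reflexive (equation p))) , p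
    smallest : ∀ {x y} → Pell d x (suc y) → (∀ k → Solvable k → y ≤ k) →
               ∀ η → IsUnit d η → _≺_ d (one d) η → _≼_ d (+ x , + suc y) η
    smallest pellₓ minimal (a , b) u 1≺η with unit≻1⇒positive d d%4≡3 {a} {b} u 1≺η
    ... | _ , k , refl , p = ≤⇒≼ d pellₓ p (s≤s (minimal k (solution p)))

  fundamental⇒minimal : .{{_ : NonZero d}} → ∀ {x y} → IsFundamentalUnit d (+ x , + y) →
    Pell d x y × 0 < y × (∀ {a b} → Pell d a b → 0 < b → y ≤ b)
  fundamental⇒minimal {x} {y} (u , 1≺ε , smallest) with unit≻1⇒positive d d%4≡3 {+ x} {+ y} u 1≺ε
  ... | _ , _ , refl , pellₓ = pellₓ , z<s ,
    λ { {b = suc _} p _ → ≼⇒≤ d pellₓ p (smallest _ (pell⇒unit d p) (pell⇒1≺ d p)) }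

-- Powers of the minimal solution

module _ {d x y : ℕ} .{{_ : NonZero d}} (pellₓ : Pell d x y) (0<y : 0 < y)
         (minimal : ∀ {a b} → Pell d a b → 0 < b → y ≤ b) where

  2≤x : 2 ≤ x
  2≤x = m*m<n*n⇒m<n {1} (subst (1 <_) (sym (equation pellₓ)) (s≤s (*-mono-≤ (>-nonZero⁻¹ d) (*-mono-≤ 0<y 0<y))))

  -- The quotient is (a + b√d)(x - y√d), so a′ = a x - d b y and b′ = b x - a y. Both are obtained
  -- as witnesses of inequalities, avoiding truncated subtraction.
  pell-divide : ∀ {a b} → Pell d a b → 0 < b →
    ∃₂ λ a′ b′ → a ≡ x * a′ + d * (y * b′) × b ≡ a′ * y + x * b′ × Pell d a′ b′
  pell-divide {a} {b} pell 0<b =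
    let (a′ , a′-eq) = m≤n⇒∃[o]m+o≡n dby≤ax
        (b′ , b′-eq) = m≤n⇒∃[o]m+o≡n ay≤bx
    in a′ , b′ , a-eq a′ b′ a′-eq b′-eq , b-eq a′ b′ a′-eq b′-eq , quotient-pell a′ b′ a′-eq b′-eq
    where
    open ≡-Reasoning
    -- Minimality enters here: the squares of the two sides are y² and b², each increased by d b²
    -- y².
    ay≤bx : a * y ≤ b * x
    ay≤bx = m*m≤n*n⇒m≤n (subst₂ _≤_ (sym lhs) (sym rhs)
              (+-monoˡ-≤ (d * (b * b) * (y * y)) (*-mono-≤ (minimal pell 0<b) (minimal pell 0<b))))
      where
      lhs : (a * y) * (a * y) ≡ y * y + d * (b * b) * (y * y)
      lhs = trans (identity a y) (cong (_* (y * y)) (equation pell))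
        where
        identity : ∀ a y → (a * y) * (a * y) ≡ (a * a) * (y * y)
        identity = solve-∀
      rhs : (b * x) * (b * x) ≡ b * b + d * (b * b) * (y * y)
      rhs = trans (identity₁ b x) (trans (cong ((b * b) *_) (equation pellₓ)) (identity₂ d b y))
        where
        identity₁ : ∀ b x → (b * x) * (b * x) ≡ (b * b) * (x * x)
        identity₁ = solve-∀
        identity₂ : ∀ d b y → (b * b) * (1 + d * (y * y)) ≡ b * b + d * (b * b) * (y * y)
        identity₂ = solve-∀
    dby≤ax : d * (b * y) ≤ a * x
    dby≤ax = m*m≤n*n⇒m≤n (subst₂ _≤_ (lhs d b y) (sym rhs)
              (*-mono-≤ (n≤1+n (d * (b * b))) (n≤1+n (d * (y * y)))))
      where
      lhs : ∀ d b y → (d * (b * b)) * (d * (y * y)) ≡ (d * (b * y)) * (d * (b * y))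
      lhs = solve-∀
      identity : ∀ a x → (a * x) * (a * x) ≡ (a * a) * (x * x)
      identity = solve-∀
      rhs : (a * x) * (a * x) ≡ (1 + d * (b * b)) * (1 + d * (y * y))
      rhs = trans (identity a x) (cong₂ _*_ (equation pell) (equation pellₓ))
    module _ (a′ b′ : ℕ) (a′-eq : d * (b * y) + a′ ≡ a * x) (b′-eq : a * y + b′ ≡ b * x) where
      -- Multiplying the quotient back by x + y√d and using x² = 1 + d y² recovers a + b√d; the
      -- terms that would be subtracted are added to both sides and cancelled.
      a-eq : a ≡ x * a′ + d * (y * b′)
      a-eq = +-cancelʳ-≡ (d * (x * (b * y)) + d * (y * (a * y))) _ _ (begin
        a + (d * (x * (b * y)) + d * (y * (a * y)))                 ≡⟨ identity₁ a b d x y ⟩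
        a * (1 + d * (y * y)) + d * (y * (b * x))                   ≡⟨ cong (λ z → a * z + d * (y * (b * x))) (equation pellₓ) ⟨
        a * (x * x) + d * (y * (b * x))                             ≡⟨ cong (_+ d * (y * (b * x))) (identity₂ a x) ⟩
        x * (a * x) + d * (y * (b * x))                             ≡⟨ cong₂ (λ s t → x * s + d * (y * t)) a′-eq b′-eq ⟨
        x * (d * (b * y) + a′) + d * (y * (a * y + b′))             ≡⟨ identity₃ a b d x y a′ b′ ⟩
        x * a′ + d * (y * b′) + (d * (x * (b * y)) + d * (y * (a * y))) ∎)
        where
        identity₁ : ∀ a b d x y → a + (d * (x * (b * y)) + d * (y * (a * y))) ≡ a * (1 + d * (y * y)) + d * (y * (b * x))
        identity₁ = solve-∀
        identity₂ : ∀ a x → a * (x * x) ≡ x * (a * x)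
        identity₂ = solve-∀
        identity₃ : ∀ a b d x y a′ b′ → x * (d * (b * y) + a′) + d * (y * (a * y + b′)) ≡
                    x * a′ + d * (y * b′) + (d * (x * (b * y)) + d * (y * (a * y)))
        identity₃ = solve-∀
      b-eq : b ≡ a′ * y + x * b′
      b-eq = +-cancelʳ-≡ (d * (b * y) * y + x * (a * y)) _ _ (begin
        b + (d * (b * y) * y + x * (a * y))                 ≡⟨ identity₁ a b d x y ⟩
        b * (1 + d * (y * y)) + (a * x) * y                 ≡⟨ cong (λ z → b * z + (a * x) * y) (equation pellₓ) ⟨
        b * (x * x) + (a * x) * y                           ≡⟨ cong (_+ (a * x) * y) (identity₂ b x) ⟩
        x * (b * x) + (a * x) * y                           ≡⟨ cong₂ (λ s t → x * t + s * y) a′-eq b′-eq ⟨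
        x * (a * y + b′) + (d * (b * y) + a′) * y           ≡⟨ identity₃ a b d x y a′ b′ ⟩
        a′ * y + x * b′ + (d * (b * y) * y + x * (a * y))   ∎)
        where
        identity₁ : ∀ a b d x y → b + (d * (b * y) * y + x * (a * y)) ≡ b * (1 + d * (y * y)) + (a * x) * y
        identity₁ = solve-∀
        identity₂ : ∀ b x → b * (x * x) ≡ x * (b * x)
        identity₂ = solve-∀
        identity₃ : ∀ a b d x y a′ b′ → x * (a * y + b′) + (d * (b * y) + a′) * y ≡
                    a′ * y + x * b′ + (d * (b * y) * y + x * (a * y))
        identity₃ = solve-∀
      -- Both sides are squares of differences, a′ = ax − c and b′ = bx − e; the cross terms
      -- 2 c a x and 2 d e b x agree, and this common value Z is cancelled.
      quotient-pell : Pell d a′ b′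
      quotient-pell = mkPell (+-cancelʳ-≡ Z _ _ (begin
        a′ * a′ + Z                                                       ≡⟨ cong (λ s → a′ * a′ + s) Z-eq₁ ⟩
        a′ * a′ + 2 * (c * (c + a′))                                      ≡⟨ complete c a′ ⟩
        (c + a′) * (c + a′) + c * c                                       ≡⟨ cong (λ s → s * s + c * c) a′-eq ⟩
        (a * x) * (a * x) + c * c                                         ≡⟨ identity₁ a b d x y ⟩
        (a * a) * (x * x) + (d * (b * b)) * (d * (y * y))                 ≡⟨ cong₂ (λ s t → s * t + (d * (b * b)) * (d * (y * y))) (equation pell) (equation pellₓ) ⟩
        (1 + d * (b * b)) * (1 + d * (y * y)) + (d * (b * b)) * (d * (y * y)) ≡⟨ identity₂ d b y ⟩
        1 + d * (b * b * (1 + d * (y * y)) + (1 + d * (b * b)) * (y * y)) ≡⟨ cong₂ (λ s t → 1 + d * (b * b * t + s * (y * y))) (equation pell) (equation pellₓ) ⟨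
        1 + d * (b * b * (x * x) + (a * a) * (y * y))                     ≡⟨ identity₃ a b d x y ⟩
        1 + d * ((b * x) * (b * x) + e * e)                               ≡⟨ cong (λ t → 1 + d * (t * t + e * e)) b′-eq ⟨
        1 + d * ((e + b′) * (e + b′) + e * e)                             ≡⟨ cong (λ s → 1 + d * s) (complete e b′) ⟨
        1 + d * (b′ * b′ + 2 * (e * (e + b′)))                            ≡⟨ cong (λ t → 1 + d * (b′ * b′ + 2 * (e * t))) b′-eq ⟩
        1 + d * (b′ * b′ + 2 * (e * (b * x)))                             ≡⟨ cong suc (*-distribˡ-+ d (b′ * b′) (2 * (e * (b * x)))) ⟩
        1 + d * (b′ * b′) + Z                                             ∎))
        where
        c = d * (b * y)
        e = a * y
        Z = d * (2 * (e * (b * x)))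
        Z-eq₁ : Z ≡ 2 * (c * (c + a′))
        Z-eq₁ = trans (identity a b d x y) (cong (λ s → 2 * (c * s)) (sym a′-eq))
          where
          identity : ∀ a b d x y → d * (2 * ((a * y) * (b * x))) ≡ 2 * ((d * (b * y)) * (a * x))
          identity = solve-∀
        complete : ∀ c s → s * s + 2 * (c * (c + s)) ≡ (c + s) * (c + s) + c * c
        complete = solve-∀
        identity₁ : ∀ a b d x y → (a * x) * (a * x) + (d * (b * y)) * (d * (b * y)) ≡
                    (a * a) * (x * x) + (d * (b * b)) * (d * (y * y))
        identity₁ = solve-∀
        identity₂ : ∀ d b y → (1 + d * (b * b)) * (1 + d * (y * y)) + (d * (b * b)) * (d * (y * y)) ≡
                    1 + d * (b * b * (1 + d * (y * y)) + (1 + d * (b * b)) * (y * y))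
        identity₂ = solve-∀
        identity₃ : ∀ a b d x y → 1 + d * (b * b * (x * x) + (a * a) * (y * y)) ≡
                    1 + d * ((b * x) * (b * x) + (a * y) * (a * y))
        identity₃ = solve-∀

  -- The properties of the k-th power a + b√d of x + y√d that matter: its size, and
  -- b ≡ k y xᵏ⁻¹, a ≡ xᵏ modulo d, the congruence being stated without subtraction.
  PowerLike : ℕ → ℕ → ℕ → Set
  PowerLike a b k = 2 ^ k ≤ a × (0 < b → 0 < k) × ∃₂ λ u v → x * b + d * u ≡ k * (y * a) + d * v

  -- Descent on a: dividing by x + y√d at least halves a, because x ≥ 2, and ends at the trivial
  -- solution with b = 0, the zeroth power.
  pell⇒powerLike : ∀ a b → Pell d a b → ∃ (PowerLike a b)
  pell⇒powerLike = <-rec (λ a → ∀ b → Pell d a b → ∃ (PowerLike a b)) step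
    where
    pell⇒0<a : ∀ {a b} → Pell d a b → 0 < a
    pell⇒0<a {zero} (mkPell ())
    pell⇒0<a {suc _} _ = z<s
    step : ∀ a → (∀ {a′} → a′ < a → ∀ b → Pell d a′ b → ∃ (PowerLike a′ b)) →
           ∀ b → Pell d a b → ∃ (PowerLike a b)
    step a rec zero pell = 0 , pell⇒0<a pell , (λ ()) , 0 , 0 , cong (_+ d * 0) (*-zeroʳ x)
    step a rec b@(suc _) pell =
      let (a′ , b′ , a-eq , b-eq , pell′) = pell-divide {a} {b} pell z<s
          (k , powerLike) = rec (a′<a a-eq pell′) b′ pell′
      in suc k , extend a-eq b-eq powerLike
      where
      a′<a : ∀ {a′ b′} → a ≡ x * a′ + d * (y * b′) → Pell d a′ b′ → a′ < a
      a′<a {a′} {b′} a-eq pell′ = begin-strict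
        a′                       <⟨ m<m+n a′ (pell⇒0<a pell′) ⟩
        a′ + a′                  ≡⟨ cong (_+_ a′) (+-identityʳ a′) ⟨
        2 * a′                   ≤⟨ *-monoˡ-≤ a′ 2≤x ⟩
        x * a′                   ≤⟨ m≤m+n (x * a′) (d * (y * b′)) ⟩
        x * a′ + d * (y * b′)    ≡⟨ a-eq ⟨
        a                        ∎
        where open ≤-Reasoning
      extend : ∀ {a′ b′ k} → a ≡ x * a′ + d * (y * b′) → b ≡ a′ * y + x * b′ →
               PowerLike a′ b′ k → PowerLike a b (suc k)
      extend {a′} {b′} {k} a-eq b-eq (2^k≤a′ , _ , u , v , congruence) =
        -- Besides x u, the first multiplier of d absorbs the summand d y b′ of a, which contributes
        -- (k + 1) y · d y b′ on the right.
        2^[1+k]≤a , (λ _ → z<s) , x * u + suc k * (y * (y * b′)) , x * v , congruence′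
        where
        2^[1+k]≤a : 2 ^ suc k ≤ a
        2^[1+k]≤a = ≤-trans (*-mono-≤ 2≤x 2^k≤a′) (≤-trans (m≤m+n (x * a′) (d * (y * b′))) (≤-reflexive (sym a-eq)))
        congruence′ : x * b + d * (x * u + suc k * (y * (y * b′))) ≡ suc k * (y * a) + d * (x * v)
        congruence′ = begin
          x * b + d * (x * u + suc k * (y * (y * b′)))                               ≡⟨ cong (λ t → x * t + d * (x * u + suc k * (y * (y * b′)))) b-eq ⟩
          x * (a′ * y + x * b′) + d * (x * u + suc k * (y * (y * b′)))               ≡⟨ identity₁ d x y a′ b′ k u ⟩
          x * (x * b′ + d * u) + (x * (a′ * y) + suc k * (y * (d * (y * b′))))       ≡⟨ cong (λ s → x * s + (x * (a′ * y) + suc k * (y * (d * (y * b′))))) congruence ⟩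
          x * (k * (y * a′) + d * v) + (x * (a′ * y) + suc k * (y * (d * (y * b′)))) ≡⟨ identity₂ d x y a′ b′ k v ⟩
          suc k * (y * (x * a′ + d * (y * b′))) + d * (x * v)                        ≡⟨ cong (λ t → suc k * (y * t) + d * (x * v)) a-eq ⟨
          suc k * (y * a) + d * (x * v)                                              ∎
          where
          open ≡-Reasoning
          identity₁ : ∀ d x y a′ b′ k u → x * (a′ * y + x * b′) + d * (x * u + suc k * (y * (y * b′))) ≡
                      x * (x * b′ + d * u) + (x * (a′ * y) + suc k * (y * (d * (y * b′))))
          identity₁ = solve-∀
          identity₂ : ∀ d x y a′ b′ k v → x * (k * (y * a′) + d * v) + (x * (a′ * y) + suc k * (y * (d * (y * b′)))) ≡
                      suc k * (y * (x * a′ + d * (y * b′))) + d * (x * v)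
          identity₂ = solve-∀

  d∣b⇒d∣y : ∀ {a b} → Prime d → Pell d a b → 0 < b → d ∣ b → a < 2 ^ d → d ∣ y
  d∣b⇒d∣y {a} {b} d-prime pell 0<b d∣b a<2^d =
    let (k , powerLike) = pell⇒powerLike a b pell in conclude powerLike
    where
    d∤k : ∀ {k} → 2 ^ k ≤ a → 0 < k → d ∤ k
    d∤k 2^k≤a 0<k d∣k =
      <⇒≱ a<2^d (≤-trans (^-monoʳ-≤ 2 (∣⇒≤ {{>-nonZero 0<k}} d∣k)) 2^k≤a)
    d∤a : d ∤ a
    d∤a d∣a = nonTrivial⇒≢1 {{prime⇒nonTrivial d-prime}} (∣1⇒≡1 (∣m+n∣m⇒∣n
      (subst (d ∣_) (trans (equation pell) (+-comm 1 (d * (b * b)))) (∣m⇒∣m*n a d∣a)) (m∣m*n (b * b))))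
    conclude : ∀ {k} → PowerLike a b k → d ∣ y
    conclude {k} (2^k≤a , 0<b⇒0<k , u , v , congruence) =
      [ (λ d∣k → contradiction d∣k (d∤k 2^k≤a (0<b⇒0<k 0<b)))
      , (λ d∣ya → [ (λ d∣y → d∣y) , (λ d∣a → contradiction d∣a d∤a) ]′ (euclidsLemma y a d-prime d∣ya))
      ]′ (euclidsLemma k (y * a) d-prime d∣kya)
      where
      d∣kya : d ∣ k * (y * a)
      d∣kya = ∣m+n∣m⇒∣n (subst (d ∣_) (trans congruence (+-comm (k * (y * a)) (d * v)))
                (∣m∣n⇒∣m+n (∣n⇒∣m*n x d∣b) (m∣m*n u))) (m∣m*n v)

-- An element of norm two

-- Squaring keeps the recursion depth at `j`, where `2 ^ (2 ^ j)` would recurse 2^j times.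
doubleExp : ℕ → ℕ
doubleExp zero = 2
doubleExp (suc j) = doubleExp j * doubleExp j

doubleExp≡2^2^ : ∀ j → doubleExp j ≡ 2 ^ (2 ^ j)
doubleExp≡2^2^ zero = refl
doubleExp≡2^2^ (suc j) = trans (cong₂ _*_ (doubleExp≡2^2^ j) (doubleExp≡2^2^ j))
  (trans (sym (^-distribˡ-+-* 2 (2 ^ j) (2 ^ j))) (cong (λ n → 2 ^ (2 ^ j + n)) (sym (+-identityʳ (2 ^ j)))))

-- Bounding a by a double exponential turns the size condition, below 2^d for the derived solution,
-- into a comparison of exponents, 2^(e+1) ≤ d.
record NormTwo (d e : ℕ) : Set where
  constructor mkNormTwo
  field
    a b : ℕ
    norm≡2 : a * a ≡ 2 + d * (b * b)
    d∣b : d ∣ b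
    a<2^2^e : a < doubleExp e

-- If β = a + b√d has norm 2, then β²/2 = (1 + d b²) + a b √d has norm 1.
module _ {d : ℕ} (d-prime : Prime d) (d%4≡3 : d % 4 ≡ 3) where

  normTwo⇒pell : ∀ {a b} → a * a ≡ 2 + d * (b * b) → Pell d (1 + d * (b * b)) (a * b)
  normTwo⇒pell {a} {b} norm≡2 = mkPell (begin
    (1 + d * (b * b)) * (1 + d * (b * b))    ≡⟨ identity₁ d b ⟩
    1 + d * ((2 + d * (b * b)) * (b * b))    ≡⟨ cong (λ s → 1 + d * (s * (b * b))) norm≡2 ⟨
    1 + d * ((a * a) * (b * b))              ≡⟨ identity₂ d a b ⟩
    1 + d * ((a * b) * (a * b))              ∎)
    where
    open ≡-Reasoning
    identity₁ : ∀ d b → (1 + d * (b * b)) * (1 + d * (b * b)) ≡ 1 + d * ((2 + d * (b * b)) * (b * b))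
    identity₁ = solve-∀
    identity₂ : ∀ d a b → 1 + d * ((a * a) * (b * b)) ≡ 1 + d * ((a * b) * (a * b))
    identity₂ = solve-∀

  normTwo⇒0<ab : ∀ {a b} → a * a ≡ 2 + d * (b * b) → 0 < a * b
  normTwo⇒0<ab {a} {zero} norm≡2 = contradiction (trans norm≡2 (cong (_+_ 2) (*-zeroʳ d))) (a*a≢2 a)
    where
    a*a≢2 : ∀ a → ¬ (a * a ≡ 2)
    a*a≢2 (suc (suc a)) eq with () ← m+n≡0⇒n≡0 a (suc-injective (suc-injective eq))
  normTwo⇒0<ab {suc a} {suc b} _ = z<s

  normTwo⇒∃fundamental : ∀ {e} → NormTwo d e → ∃₂ λ x y → IsFundamentalUnit d (+ x , + y)
  normTwo⇒∃fundamental (mkNormTwo a b norm≡2 _ _) = pell⇒∃fundamental d d%4≡3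
    (1 + d * (b * b) , a * b ∸ 1 , subst (Pell d (1 + d * (b * b)))
      (sym (m+[n∸m]≡n (normTwo⇒0<ab {a} norm≡2))) (normTwo⇒pell {a} norm≡2))

  normTwo⇒d∣y : ∀ {e} → 2 ^ suc e ≤ d → NormTwo d e → ∀ x y → IsFundamentalUnit d (+ x , + y) → d ∣ y
  normTwo⇒d∣y {e} 2^[1+e]≤d (mkNormTwo a b norm≡2 d∣b a<) x y fundamental =
    let (pellₓ , 0<y , minimal) = fundamental⇒minimal d d%4≡3 fundamental
    in d∣b⇒d∣y pellₓ 0<y minimal d-prime (normTwo⇒pell {a} norm≡2) (normTwo⇒0<ab {a} norm≡2) (∣n⇒∣m*n a d∣b) bound
    where
    instance
      _ = prime⇒nonZero d-prime
    open ≤-Reasoning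
    -- This is the first coordinate of β²/2; it equals a² - 1, and squaring the bound on a raises
    -- `e` by one.
    bound : 1 + d * (b * b) < 2 ^ d
    bound = begin-strict
      1 + d * (b * b)  <⟨ n<1+n _ ⟩
      2 + d * (b * b)  ≡⟨ norm≡2 ⟨
      a * a            ≤⟨ *-mono-≤ (<⇒≤ a<) (<⇒≤ a<) ⟩
      doubleExp (suc e) ≡⟨ doubleExp≡2^2^ (suc e) ⟩
      2 ^ (2 ^ suc e)  ≤⟨ ^-monoʳ-≤ 2 2^[1+e]≤d ⟩
      2 ^ d            ∎

-- A Boolean test, so that the huge coordinates are only compared numerically and never appear in
-- unary proofs.
isNormTwo : (d : ℕ) .{{_ : NonZero d}} → ℕ → ℕ × ℕ → Bool
isNormTwo d e (a , b) = (a * a ≡ᵇ 2 + d * (b * b)) ∧ (b % d ≡ᵇ 0) ∧ (a <ᵇ doubleExp e)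

isNormTwo⇒normTwo : ∀ d .{{_ : NonZero d}} e β → T (isNormTwo d e β) → NormTwo d e
isNormTwo⇒normTwo d e (a , b) ok =
  let (norm-ok , rest) = Equivalence.to T-∧ ok
      (∣-ok , <-ok) = Equivalence.to T-∧ rest
  in mkNormTwo a b (≡ᵇ⇒≡ _ _ norm-ok) (m%n≡0⇒n∣m b d (≡ᵇ⇒≡ _ _ ∣-ok)) (<ᵇ⇒< a (doubleExp e) <-ok)

-- The element (p + q√d) (a + b√d)² / n², where n is the absolute norm of a + b√d and
-- p + q√d lies in the square of the conjugate ideal, so that the division is exact.
step : (p q n : ℕ) .{{_ : NonZero n}} → ℕ × ℕ → ℕ × ℕ
step p q n (a , b) = times (a * a + 39028039587479 * (b * b)) (2 * (a * b))
  where
  instance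
    n*n≢0 : NonZero (n * n)
    n*n≢0 = m*n≢0 n n
  times : ℕ → ℕ → ℕ × ℕ
  times u v = (p * u + 39028039587479 * (q * v)) / (n * n) , (p * v + q * u) / (n * n)

-- A compact representation of the element of norm 2 found halfway through the period of
-- the continued fraction of √d, starting from ⌊√d⌋ + √d. Each step doubles the logarithm
-- up to a bounded error, and the elements are convergents, so their norms stay below 2√d.
β : ℕ × ℕ
β =
  step 4795527074653 767623 2062553 (
  step 9366184687724 1499251 558307 (
  step 111350482665334 17823941 6742643 (
  step 765954823822 122607 438047 (
  step 14875158917929 2381076 5243423 (
  step 1479288126363 236792 2245163 (
  step 157130500961598 25151977 5139907 (
  step 33514932758198 5364757 8460941 (
  step 73030509304010 11690039 1609801 (
  step 6580134098524 1053285 7682749 (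
  step 32322277982817 5173846 7707085 (
  step 705970620210 113005 422605 (
  step 162414200336731 25997742 8021639 (
  step 610597668751 97740 1091029 (
  step 38221716995175 6118174 224993 (
  step 356417735803 57052 411101 (
  step 2252841327274 360613 6980915 (
  6247242 , 1)))))))))))))))))

normTwo : NormTwo 39028039587479 22
-- Checking `tt` evaluates the compact representation and tests the resulting pair. The exponent 22
-- is large enough since 2²² exceeds the bit length of about three million.
normTwo = isNormTwo⇒normTwo 39028039587479 22 β tt

prime-39028039587479 : Prime 39028039587479
-- The 6247241 trial divisors run from 2 to 6247242 = ⌊√d⌋.
prime-39028039587479 = survivesTrials⇒prime 39028039587479 6247241 refl (<ᵇ⇒< _ _ tt)

theorem1p3 : Prime 39028039587479
    × 39028039587479 % 4 ≡ 3
    × ∃₂ (λ (x y : ℕ) → IsFundamentalUnit 39028039587479 (+ x , + y))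
    × ((x y : ℕ) → IsFundamentalUnit 39028039587479 (+ x , + y) → 39028039587479 ∣ y)
theorem1p3 =
    prime-39028039587479
  , refl
  , normTwo⇒∃fundamental prime-39028039587479 refl normTwo
  -- The inequality decided by evaluation is 2²³ ≤ d.
  , normTwo⇒d∣y prime-39028039587479 refl (≤ᵇ⇒≤ _ _ tt) normTwo
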